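{- For every $k\ge2$, the integrality gap of (LP-MHV), the linear programming relaxation of the MHV problem with $k$ colors, has an upper bound of $\frac2k$: $$\inf_{I}\ \frac{\mathrm{OPT}(\mathrm{MHV})(I)}{\mathrm{OPT}(\text{LP-MHV})(I)}\ \le\ \frac2k,$$ where the infimum is over all MHV instances $I$ with $k$ colors and $\mathrm{OPT}(\text{LP-MHV})(I)>0$.
   Context: **MHV problem.** An instance consists of a finite undirected graph $G=(V,E)$, $V=\{v_1,\dots,v_n\}$, non-negative vertex weights $w_j=w(v_j)$, a color set $C=\{1,\dots,k\}$, and a partial vertex coloring $c$ with colors in $C$ in which every color is used on at least one vertex. $\mathrm{OPT}(\mathrm{MHV})(I)$ is the maximum, over all colorings of $V$ extending $c$, of the total weight of happy vertices (vertices having the same color as all their neighbors). **(LP-MHV).** $\mathrm{OPT}(\text{LP-MHV})(I)$ is the optimum value of: maximize $\sum_{j=1}^n w_jz_j$ subject to: $\sum_{i=1}^k y_j^i=1$ for all $v_j\in V$; $y_j^i=1$ whenever $c(v_j)=i$; $z_j^i=\min_{v_h\in N[v_j]}y_h^i$ for all $v_j\in V$, $i\in C$; $z_j=\sum_{i=1}^k z_j^i$ for all $v_j\in V$; and $z_j,z_j^i,y_j^i\ge0$. Here $N[v_j]$ is the closed neighborhood of $v_j$. -}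

module Defs where

open import Algebra.Bundles using (CommutativeRing; Semiring)
open import Data.Fin using (Fin)
open import Data.Fin.Properties using (_≟_; all?)
open import Data.Maybe using (Maybe; just)
open import Data.Nat using (ℕ)
open import Data.Product using (∃; ∃-syntax; _×_)
open import Data.Sum using (_⊎_)
open import Level using (Level; _⊔_; suc; 0ℓ)
open import Relation.Binary using (Rel; Decidable; Symmetric; Irreflexive; IsTotalOrder)
import Relation.Binary.Construct.NonStrictToStrict as NonStrictToStrict
open import Relation.Binary.PropositionalEquality using (_≡_)
open import Relation.Nullary using (Dec; ¬_; does)
open import Relation.Nullary.Decidable using (_→-dec_)
open import Relation.Unary using (Pred; _∈_)
open import Data.Bool using (if_then_else_)
import Algebra.Definitions.RawSemiring as RawSemiringDefs

------------------------------------------------------------------------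
-- Ordered fields

-- The real numbers enter only as an ordered field, so everything below is
-- stated over an arbitrary (totally) ordered field, such as ℚ or the
-- classical reals.
record OrderedField (c ℓ₁ ℓ₂ : Level) : Set (suc (c ⊔ ℓ₁ ⊔ ℓ₂)) where
  field
    commutativeRing : CommutativeRing c ℓ₁

  open CommutativeRing commutativeRing public

  infix  4 _≤_
  infix  8 _⁻¹
  infixl 7 _/_

  field
    _≤_          : Rel Carrier ℓ₂
    isTotalOrder : IsTotalOrder _≈_ _≤_
    +-monoʳ-≤    : ∀ x {y z} → y ≤ z → x + y ≤ x + z
    *-nonNeg     : ∀ {x y} → 0# ≤ x → 0# ≤ y → 0# ≤ x * y
    0≉1          : ¬ 0# ≈ 1#
    -- Total for convenience: the value at 0# is unconstrained.
    _⁻¹          : Carrier → Carrier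
    ⁻¹-inverseʳ  : ∀ {x} → ¬ x ≈ 0# → x * x ⁻¹ ≈ 1#

  open IsTotalOrder isTotalOrder public
    using (total; antisym)
    renaming (refl to ≤-refl; reflexive to ≤-reflexive; trans to ≤-trans)

  open NonStrictToStrict _≈_ _≤_ public using (_<_)

  open RawSemiringDefs (Semiring.rawSemiring semiring) public
    using (sum) renaming (_×_ to _·_)

  _/_ : Carrier → Carrier → Carrier
  x / y = x * y ⁻¹

  fromℕ : ℕ → Carrier
  fromℕ n = n · 1#

module Extrema {c ℓ₁ ℓ₂} (F : OrderedField c ℓ₁ ℓ₂) where
  open OrderedField F

  IsMinimum : ∀ {p} → Pred Carrier p → Carrier → Set (c ⊔ ℓ₂ ⊔ p)
  IsMinimum S m = m ∈ S × (∀ x → x ∈ S → m ≤ x)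

  IsMaximum : ∀ {p} → Pred Carrier p → Carrier → Set (c ⊔ ℓ₂ ⊔ p)
  IsMaximum S m = m ∈ S × (∀ x → x ∈ S → x ≤ m)

  IsLowerBound : ∀ {p} → Pred Carrier p → Carrier → Set (c ⊔ ℓ₂ ⊔ p)
  IsLowerBound S b = ∀ x → x ∈ S → b ≤ x

  -- inf S ≤ a, the infimum being the greatest lower bound.  Quantifying over
  -- all lower bounds also makes sense when inf S is not an element of the
  -- field, and is false for empty S (inf ∅ = +∞).
  Inf_AtMost_ : ∀ {p} → Pred Carrier p → Carrier → Set (c ⊔ ℓ₂ ⊔ p)
  Inf S AtMost a = ∀ b → IsLowerBound S b → b ≤ a

------------------------------------------------------------------------
-- Graphs on the vertex set Fin n

record Graph (n : ℕ) : Set (suc 0ℓ) where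
  field
    Adj    : Rel (Fin n) 0ℓ
    adj?   : Decidable Adj
    sym    : Symmetric Adj
    irrefl : Irreflexive _≡_ Adj

  N[_] : Fin n → Pred (Fin n) 0ℓ
  N[ j ] h = h ≡ j ⊎ Adj j h

------------------------------------------------------------------------
-- Maximum happy vertices

module MHV {c ℓ₁ ℓ₂} (F : OrderedField c ℓ₁ ℓ₂) where
  open OrderedField F
  open Extrema F

  record Instance (k : ℕ) : Set (suc 0ℓ ⊔ c ⊔ ℓ₂) where
    field
      n             : ℕ
      graph         : Graph n
      weight        : Fin n → Carrier
      weight-nonNeg : ∀ j → 0# ≤ weight j
      precolor      : Fin n → Maybe (Fin k)
      color-used    : ∀ i → ∃[ j ] precolor j ≡ just i

    open Graph graph public using (Adj; adj?; N[_])

  module _ {k : ℕ} (I : Instance k) where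
    open Instance I

    Extends : (Fin n → Fin k) → Set
    Extends f = ∀ j i → precolor j ≡ just i → f j ≡ i

    Happy : (Fin n → Fin k) → Fin n → Set
    Happy f j = ∀ h → Adj j h → f h ≡ f j

    happy? : ∀ f j → Dec (Happy f j)
    happy? f j = all? λ h → adj? j h →-dec (f h ≟ f j)

    happyWeight : (Fin n → Fin k) → Carrier
    happyWeight f = sum λ j → if does (happy? f j) then weight j else 0#

    MHVValues : Pred Carrier ℓ₁
    MHVValues x = ∃[ f ] Extends f × x ≈ happyWeight f

    IsOptMHV : Carrier → Set (c ⊔ ℓ₁ ⊔ ℓ₂)
    IsOptMHV = IsMaximum MHVValues

    -- y j i, zᶜ j i and z j are the variables yⱼⁱ, zⱼⁱ and zⱼ.
    record LPFeasible (y zᶜ : Fin n → Fin k → Carrier) (z : Fin n → Carrier)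
                      : Set (c ⊔ ℓ₁ ⊔ ℓ₂) where
      field
        y-sum     : ∀ j → sum (y j) ≈ 1#
        y-color   : ∀ j i → precolor j ≡ just i → y j i ≈ 1#
        zᶜ-min    : ∀ j i → IsMinimum (λ x → ∃[ h ] h ∈ N[ j ] × x ≈ y h i) (zᶜ j i)
        z-sum     : ∀ j → z j ≈ sum (zᶜ j)
        y-nonNeg  : ∀ j i → 0# ≤ y j i
        zᶜ-nonNeg : ∀ j i → 0# ≤ zᶜ j i
        z-nonNeg  : ∀ j → 0# ≤ z j

    LPValues : Pred Carrier (c ⊔ ℓ₁ ⊔ ℓ₂)
    LPValues x = ∃[ y ] ∃[ zᶜ ] ∃[ z ]
      LPFeasible y zᶜ z × x ≈ sum (λ j → weight j * z j)

    IsOptLP : Carrier → Set (c ⊔ ℓ₁ ⊔ ℓ₂)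
    IsOptLP = IsMaximum LPValues

  -- The values OPT(MHV)(I) / OPT(LP-MHV)(I) over instances I with k colors
  -- and OPT(LP-MHV)(I) > 0.
  GapRatios : ℕ → Pred Carrier (suc 0ℓ ⊔ c ⊔ ℓ₁ ⊔ ℓ₂)
  GapRatios k r = ∃ λ (I : Instance k) → ∃[ opt ] ∃[ lp ]
    IsOptMHV I opt × IsOptLP I lp × 0# < lp × r ≈ opt / lp

{-# OPTIONS --safe #-}
-- One instance attains the ratio 2/k.  It has a terminal of weight 1
-- precolored a for each color a, and for every pair (a , b) an uncolored link
-- of weight 0 adjacent to the terminals a and b.  Two terminals cannot both be
-- happy because of the link between them, so OPT(MHV) = 1.  In the LP, giving
-- each link (a , b) half of color a and half of color b makes every terminal
-- half happy, for a value of k/2; and this is optimal because the links force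
-- z_a + z_b ≤ 1 for every pair of distinct terminals.
module Submission where

open import Defs
open import Data.Nat using (ℕ; s≤s) renaming (_≤_ to _≤ℕ_; _+_ to _+ℕ_; _*_ to _*ℕ_)

import Algebra.Properties.AbelianGroup as AbelianGroupProperties
import Algebra.Properties.Ring as RingProperties
import Algebra.Properties.Semiring.Sum as SumProperties
import Algebra.Solver.CommutativeMonoid as CommutativeMonoidSolver
open import Data.Bool using (Bool; true; false; if_then_else_)
open import Data.Empty using (⊥)
open import Data.Fin using (Fin; zero; suc; _↑ˡ_; _↑ʳ_; splitAt; combine; remQuot)
open import Data.Fin.Properties using (_≟_; any?; suc-injective; splitAt-↑ˡ; splitAt-↑ʳ; remQuot-combine)
open import Data.Maybe using (Maybe; just; nothing)
open import Data.Product using (∃-syntax; _×_; _,_; uncurry)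
open import Data.Sum using (_⊎_; inj₁; inj₂; [_,_])
open import Function using (_∘_; const)
open import Relation.Binary using (IsTotalOrder; Poset)
import Relation.Binary.Reasoning.PartialOrder as PosetReasoning
open import Relation.Binary.PropositionalEquality as ≡ using (_≡_; _≢_)
open import Relation.Nullary using (¬_; Dec; yes; no; does; contradiction)
open import Relation.Nullary.Decidable using (_⊎-dec_)
open import Relation.Unary using (_∈_)

if-yes : ∀ {a p} {A : Set a} {P : Set p} (P? : Dec P) {x y : A} →
         P → (if does P? then x else y) ≡ x
if-yes (yes _) _ = ≡.refl
if-yes (no ¬p) p = contradiction p ¬p

if-no : ∀ {a p} {A : Set a} {P : Set p} (P? : Dec P) {x y : A} →
        ¬ P → (if does P? then x else y) ≡ y
if-no (yes p) ¬p = contradiction p ¬p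
if-no (no _)  _  = ≡.refl

if-both : ∀ {a q} {A : Set a} (Q : A → Set q) (b : Bool) {x y : A} →
          Q x → Q y → Q (if b then x else y)
if-both Q true  qx qy = qx
if-both Q false qx qy = qy

-- Arithmetic in an ordered field.

module OrderedFieldProperties {c ℓ₁ ℓ₂} (F : OrderedField c ℓ₁ ℓ₂) where
  open OrderedField F hiding (zero)
  open RingProperties ring using (-‿distribˡ-*; -‿distribʳ-*)
  open AbelianGroupProperties +-abelianGroup using (⁻¹-involutive; \\-leftDividesʳ)
  open SumProperties semiring using (sum-cong-≋; sum-replicate-zero)
  open CommutativeMonoidSolver +-commutativeMonoid using (solve; _⊕_; _⊜_; id)

  poset : Poset c ℓ₁ ℓ₂
  poset = record { isPartialOrder = IsTotalOrder.isPartialOrder isTotalOrder }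

  open PosetReasoning poset

  +-monoˡ-≤ : ∀ x {y z} → y ≤ z → y + x ≤ z + x
  +-monoˡ-≤ x {y} {z} y≤z = begin
    y + x  ≈⟨ +-comm y x ⟩
    x + y  ≤⟨ +-monoʳ-≤ x y≤z ⟩
    x + z  ≈⟨ +-comm x z ⟩
    z + x  ∎

  +-mono-≤ : ∀ {x y u v} → x ≤ y → u ≤ v → x + u ≤ y + v
  +-mono-≤ {y = y} {u} x≤y u≤v = ≤-trans (+-monoˡ-≤ u x≤y) (+-monoʳ-≤ y u≤v)

  +-cancelˡ-≤ : ∀ x {y z} → x + y ≤ x + z → y ≤ z
  +-cancelˡ-≤ x {y} {z} x+y≤x+z = begin
    y              ≈⟨ \\-leftDividesʳ x y ⟨
    - x + (x + y)  ≤⟨ +-monoʳ-≤ (- x) x+y≤x+z ⟩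
    - x + (x + z)  ≈⟨ \\-leftDividesʳ x z ⟩
    z              ∎

  x≤y⇒0≤y-x : ∀ {x y} → x ≤ y → 0# ≤ y + - x
  x≤y⇒0≤y-x {x} {y} x≤y = begin
    0#       ≈⟨ -‿inverseʳ x ⟨
    x + - x  ≤⟨ +-monoˡ-≤ (- x) x≤y ⟩
    y + - x  ∎

  x≤y+x : ∀ {x y} → 0# ≤ y → x ≤ y + x
  x≤y+x {x} {y} 0≤y = begin
    x       ≈⟨ +-identityˡ x ⟨
    0# + x  ≤⟨ +-monoˡ-≤ x 0≤y ⟩
    y + x   ∎

  x≤x+y : ∀ {x y} → 0# ≤ y → x ≤ x + y
  x≤x+y {x} {y} 0≤y = ≤-trans (x≤y+x 0≤y) (≤-reflexive (+-comm y x))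

  *-monoˡ-≤-nonNeg : ∀ {x y z} → 0# ≤ x → y ≤ z → x * y ≤ x * z
  *-monoˡ-≤-nonNeg {x} {y} {z} 0≤x y≤z = begin
    x * y                    ≤⟨ x≤y+x (*-nonNeg 0≤x (x≤y⇒0≤y-x y≤z)) ⟩
    x * (z + - y) + x * y    ≈⟨ distribˡ x (z + - y) y ⟨
    x * (z + - y + y)        ≈⟨ *-congˡ (+-assoc z (- y) y) ⟩
    x * (z + (- y + y))      ≈⟨ *-congˡ (+-congˡ (-‿inverseˡ y)) ⟩
    x * (z + 0#)             ≈⟨ *-congˡ (+-identityʳ z) ⟩
    x * z                    ∎

  x*y≤x : ∀ {x y} → 0# ≤ x → y ≤ 1# → x * y ≤ x
  x*y≤x {x} 0≤x y≤1 =
    ≤-trans (*-monoˡ-≤-nonNeg 0≤x y≤1) (≤-reflexive (*-identityʳ x))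

  0≤1 : 0# ≤ 1#
  0≤1 with total 0# 1#
  ... | inj₁ 0≤1 = 0≤1
  -- If `1# ≤ 0#`, then `- 1#` is non-negative, and so is its square, which is `1#`.
  ... | inj₂ 1≤0 = begin
    0#             ≤⟨ *-nonNeg 0≤-1 0≤-1 ⟩
    - 1# * - 1#    ≈⟨ -‿distribˡ-* 1# (- 1#) ⟨
    - (1# * - 1#)  ≈⟨ -‿cong (*-identityˡ (- 1#)) ⟩
    - (- 1#)       ≈⟨ ⁻¹-involutive 1# ⟩
    1#             ∎
    where
    0≤-1 : 0# ≤ - 1#
    0≤-1 = ≤-trans (x≤y⇒0≤y-x 1≤0) (≤-reflexive (+-identityˡ (- 1#)))

  1≰0 : ¬ 1# ≤ 0#
  1≰0 1≤0 = 0≉1 (antisym 0≤1 1≤0)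

  fromℕ-nonNeg : ∀ n → 0# ≤ fromℕ n
  fromℕ-nonNeg ℕ.zero    = ≤-refl
  fromℕ-nonNeg (ℕ.suc n) = ≤-trans 0≤1 (x≤x+y (fromℕ-nonNeg n))

  fromℕ-suc≉0 : ∀ n → ¬ fromℕ (ℕ.suc n) ≈ 0#
  fromℕ-suc≉0 n 1+n≈0 =
    1≰0 (≤-trans (x≤x+y (fromℕ-nonNeg n)) (≤-reflexive 1+n≈0))

  fromℕ-≥2≉0 : ∀ {n} → 2 ≤ℕ n → ¬ fromℕ n ≈ 0#
  fromℕ-≥2≉0 {ℕ.suc n} (s≤s _) = fromℕ-suc≉0 n

  -- `⁻¹` is given without a congruence law, so an inverse is identified with another expression by
  -- checking a product. The equation itself rules out `x ≈ 0#`, where `⁻¹` is unconstrained.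
  *-inverse-unique : ∀ {x y} → x * y ≈ 1# → y ≈ x ⁻¹
  *-inverse-unique {x} {y} xy≈1 = begin-equality
    y               ≈⟨ *-identityʳ y ⟨
    y * 1#          ≈⟨ *-congˡ (⁻¹-inverseʳ x≉0) ⟨
    y * (x * x ⁻¹)  ≈⟨ *-assoc y x (x ⁻¹) ⟨
    y * x * x ⁻¹    ≈⟨ *-congʳ (trans (*-comm y x) xy≈1) ⟩
    1# * x ⁻¹       ≈⟨ *-identityˡ (x ⁻¹) ⟩
    x ⁻¹            ∎
    where
    x≉0 : ¬ x ≈ 0#
    x≉0 x≈0 = 0≉1 (trans (sym (zeroˡ y)) (trans (*-congʳ (sym x≈0)) xy≈1))

  /-*-/-cancel : ∀ {x y} → ¬ x ≈ 0# → ¬ y ≈ 0# → x / y * (y / x) ≈ 1#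
  /-*-/-cancel {x} {y} x≉0 y≉0 = begin-equality
    x * y ⁻¹ * (y * x ⁻¹)    ≈⟨ *-assoc x (y ⁻¹) (y * x ⁻¹) ⟩
    x * (y ⁻¹ * (y * x ⁻¹))  ≈⟨ *-congˡ (*-assoc (y ⁻¹) y (x ⁻¹)) ⟨
    x * (y ⁻¹ * y * x ⁻¹)    ≈⟨ *-congˡ (*-congʳ (trans (*-comm (y ⁻¹) y) (⁻¹-inverseʳ y≉0))) ⟩
    x * (1# * x ⁻¹)          ≈⟨ *-congˡ (*-identityˡ (x ⁻¹)) ⟩
    x * x ⁻¹                 ≈⟨ ⁻¹-inverseʳ x≉0 ⟩
    1#                       ∎

  ½ : Carrier
  ½ = fromℕ 2 ⁻¹

  ½+½≈1 : ½ + ½ ≈ 1#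
  ½+½≈1 = begin-equality
    ½ + ½            ≈⟨ +-cong (*-identityˡ ½) (*-identityˡ ½) ⟨
    1# * ½ + 1# * ½  ≈⟨ distribʳ ½ 1# 1# ⟨
    (1# + 1#) * ½    ≈⟨ *-congʳ (+-congˡ (+-identityʳ 1#)) ⟨
    fromℕ 2 * ½      ≈⟨ ⁻¹-inverseʳ (fromℕ-suc≉0 1) ⟩
    1#               ∎

  ½*[x+x]≈x : ∀ x → ½ * (x + x) ≈ x
  ½*[x+x]≈x x = begin-equality
    ½ * (x + x)    ≈⟨ distribˡ ½ x x ⟩
    ½ * x + ½ * x  ≈⟨ distribʳ x ½ ½ ⟨
    (½ + ½) * x    ≈⟨ *-congʳ ½+½≈1 ⟩
    1# * x         ≈⟨ *-identityˡ x ⟩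
    x              ∎

  0≤½ : 0# ≤ ½
  0≤½ with total 0# ½
  ... | inj₁ 0≤½ = 0≤½
  -- The sign of an inverse is not an axiom; it comes from `½ + ½ ≈ 1#`, as two non-positive halves
  -- would give `1# ≤ 0#`.
  ... | inj₂ ½≤0 = contradiction 1≤0 1≰0
    where
    1≤0 : 1# ≤ 0#
    1≤0 = begin
      1#       ≈⟨ ½+½≈1 ⟨
      ½ + ½    ≤⟨ +-mono-≤ ½≤0 ½≤0 ⟩
      0# + 0#  ≈⟨ +-identityˡ 0# ⟩
      0#       ∎

  ½≤1 : ½ ≤ 1#
  ½≤1 = ≤-trans (x≤x+y 0≤½) (≤-reflexive ½+½≈1)

  -- Finite sums.

  sum-zero : ∀ {n} {f : Fin n → Carrier} → (∀ i → f i ≈ 0#) → sum f ≈ 0#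
  sum-zero {n} f≈0 = trans (sum-cong-≋ f≈0) (sum-replicate-zero n)

  sum-single : ∀ {n} {f : Fin n → Carrier} a → (∀ i → i ≢ a → f i ≈ 0#) → sum f ≈ f a
  sum-single {f = f} zero    f≈0 =
    trans (+-congˡ (sum-zero (λ i → f≈0 (suc i) λ ()))) (+-identityʳ (f zero))
  sum-single {f = f} (suc a) f≈0 = begin-equality
    f zero + sum (f ∘ suc)  ≈⟨ +-cong (f≈0 zero λ ())
                                      (sum-single a λ i i≢a → f≈0 (suc i) (i≢a ∘ suc-injective)) ⟩
    0# + f (suc a)          ≈⟨ +-identityˡ (f (suc a)) ⟩
    f (suc a)               ∎

  sum-split : ∀ m {n} (f : Fin (m +ℕ n) → Carrier) →
              sum f ≈ sum (f ∘ (_↑ˡ n)) + sum (f ∘ (m ↑ʳ_))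
  sum-split ℕ.zero    f = sym (+-identityˡ (sum f))
  sum-split (ℕ.suc m) f =
    trans (+-congˡ (sum-split m (f ∘ suc))) (sym (+-assoc (f zero) _ _))

  sum-nonNeg : ∀ {n} {f : Fin n → Carrier} → (∀ i → 0# ≤ f i) → 0# ≤ sum f
  sum-nonNeg {ℕ.zero}  0≤f = ≤-refl
  sum-nonNeg {ℕ.suc n} 0≤f = ≤-trans (sum-nonNeg (0≤f ∘ suc)) (x≤y+x (0≤f zero))

  term≤sum : ∀ {n} {f : Fin n → Carrier} → (∀ i → 0# ≤ f i) → ∀ a → f a ≤ sum f
  term≤sum 0≤f zero    = x≤x+y (sum-nonNeg (0≤f ∘ suc))
  term≤sum 0≤f (suc a) = ≤-trans (term≤sum (0≤f ∘ suc) a) (x≤y+x (0≤f zero))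

  pair≤sum : ∀ {n} {f : Fin n → Carrier} → (∀ i → 0# ≤ f i) →
             ∀ {a b} → a ≢ b → f a + f b ≤ sum f
  pair≤sum 0≤f {zero}  {zero}  a≢b = contradiction ≡.refl a≢b
  pair≤sum 0≤f {zero}  {suc b} a≢b = +-monoʳ-≤ _ (term≤sum (0≤f ∘ suc) b)
  pair≤sum 0≤f {suc a} {zero}  a≢b =
    ≤-trans (≤-reflexive (+-comm _ _)) (+-monoʳ-≤ _ (term≤sum (0≤f ∘ suc) a))
  pair≤sum 0≤f {suc a} {suc b} a≢b =
    ≤-trans (pair≤sum (0≤f ∘ suc) (a≢b ∘ ≡.cong suc)) (x≤y+x (0≤f zero))

  -- Two indices are peeled off at a time; for an odd number of terms the
  -- recursion ends with a triangle.
  double-sum≤ : ∀ n (g : Fin n → Carrier) → n ≢ 1 →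
                (∀ {a b} → a ≢ b → g a + g b ≤ 1#) → sum g + sum g ≤ fromℕ n
  double-sum≤-step : ∀ n (g : Fin (2 +ℕ n) → Carrier) → n ≢ 1 →
                     (∀ {a b} → a ≢ b → g a + g b ≤ 1#) → sum g + sum g ≤ fromℕ (2 +ℕ n)

  double-sum≤ 0 g n≢1 g≤1 = ≤-reflexive (+-identityʳ 0#)
  -- A single term belongs to no pair of distinct indices, so nothing would bound it.
  double-sum≤ 1 g n≢1 g≤1 = contradiction ≡.refl n≢1
  double-sum≤ 2 g n≢1 g≤1 = double-sum≤-step 0 g (λ ()) g≤1
  double-sum≤ 3 g n≢1 g≤1 = begin
    sum g + sum g
      -- Each of the three terms lies in two of the three pairs, so the doubled sum is exactly the
      -- sum over the pairs.
      ≈⟨ solve 3 (λ x y z → (x ⊕ (y ⊕ (z ⊕ id))) ⊕ (x ⊕ (y ⊕ (z ⊕ id)))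
                          ⊜ (x ⊕ y) ⊕ ((y ⊕ z) ⊕ ((x ⊕ z) ⊕ id)))
               refl (g zero) (g (suc zero)) (g (suc (suc zero))) ⟩
    (g zero + g (suc zero)) + ((g (suc zero) + g (suc (suc zero))) + ((g zero + g (suc (suc zero))) + 0#))
      ≤⟨ +-mono-≤ (g≤1 λ ()) (+-mono-≤ (g≤1 λ ()) (+-mono-≤ (g≤1 λ ()) ≤-refl)) ⟩
    fromℕ 3 ∎
  double-sum≤ (ℕ.suc (ℕ.suc n@(ℕ.suc (ℕ.suc _)))) g n≢1 g≤1 = double-sum≤-step n g (λ ()) g≤1

  double-sum≤-step n g n≢1 g≤1 = begin
    sum g + sum g
      ≈⟨ solve 3 (λ x y s → (x ⊕ (y ⊕ s)) ⊕ (x ⊕ (y ⊕ s)) ⊜ (x ⊕ y) ⊕ ((x ⊕ y) ⊕ (s ⊕ s)))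
               refl (g zero) (g (suc zero)) s ⟩
    (g zero + g (suc zero)) + ((g zero + g (suc zero)) + (s + s))
      ≤⟨ +-mono-≤ (g≤1 λ ()) (+-mono-≤ (g≤1 λ ())
           (double-sum≤ n (g ∘ suc ∘ suc) n≢1
             λ a≢b → g≤1 (a≢b ∘ suc-injective ∘ suc-injective))) ⟩
    fromℕ (2 +ℕ n) ∎
    where
    s : Carrier
    s = sum (g ∘ suc ∘ suc)

-- The gadget graph.

someElement : ∀ {n} → 2 ≤ℕ n → Fin n
someElement (s≤s _) = zero

another : ∀ {n} → 2 ≤ℕ n → (a : Fin n) → ∃[ b ] b ≢ a
another (s≤s (s≤s _)) zero    = suc zero , λ ()
another (s≤s (s≤s _)) (suc _) = zero , λ ()

2≤n⇒n≢1 : ∀ {n} → 2 ≤ℕ n → n ≢ 1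
2≤n⇒n≢1 (s≤s ()) ≡.refl

module Gadget {k : ℕ} (2≤k : 2 ≤ℕ k) where

  -- Links are indexed by all ordered pairs, the diagonal included, so that they correspond to
  -- `Fin (k * k)` through `combine` and `remQuot`. The duplicates and the links `link a a` are
  -- harmless: links weigh nothing, and `link a a` can simply take color `a`.
  data Vertex : Set where
    terminal : Fin k → Vertex
    link     : Fin k → Fin k → Vertex

  _~_ : Vertex → Vertex → Set
  terminal a ~ link b c   = a ≡ b ⊎ a ≡ c
  link b c   ~ terminal a = a ≡ b ⊎ a ≡ c
  terminal _ ~ terminal _ = ⊥
  link _ _   ~ link _ _   = ⊥

  _~?_ : ∀ u v → Dec (u ~ v)
  terminal a ~? link b c   = (a ≟ b) ⊎-dec (a ≟ c)
  link b c   ~? terminal a = (a ≟ b) ⊎-dec (a ≟ c)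
  terminal _ ~? terminal _ = no λ ()
  link _ _   ~? link _ _   = no λ ()

  ~-sym : ∀ u v → u ~ v → v ~ u
  ~-sym (terminal _) (link _ _)   u~v = u~v
  ~-sym (link _ _)   (terminal _) u~v = u~v

  ~-irrefl : ∀ u → ¬ u ~ u
  ~-irrefl (terminal _) ()
  ~-irrefl (link _ _)   ()

  size : ℕ
  size = k +ℕ k *ℕ k

  someColor : Fin k
  someColor = someElement 2≤k

  T : Fin k → Fin size
  T a = a ↑ˡ (k *ℕ k)

  L : Fin k → Fin k → Fin size
  L a b = k ↑ʳ combine a b

  decode : Fin size → Vertex
  decode j = [ terminal , uncurry link ∘ remQuot k ] (splitAt k j)

  encode : Vertex → Fin size
  encode (terminal a) = T a
  encode (link a b)   = L a b

  decode-↑ʳ : ∀ p → decode (k ↑ʳ p) ≡ uncurry link (remQuot k p)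
  decode-↑ʳ p = ≡.cong [ terminal , uncurry link ∘ remQuot k ] (splitAt-↑ʳ k (k *ℕ k) p)

  decode-encode : ∀ v → decode (encode v) ≡ v
  decode-encode (terminal a) =
    ≡.cong [ terminal , uncurry link ∘ remQuot k ] (splitAt-↑ˡ k a (k *ℕ k))
  decode-encode (link a b)   =
    ≡.trans (decode-↑ʳ (combine a b)) (≡.cong (uncurry link) (remQuot-combine a b))

  decode-T : ∀ a → decode (T a) ≡ terminal a
  decode-T a = decode-encode (terminal a)

  graph : Graph size
  graph = record
    { Adj    = λ i j → decode i ~ decode j
    ; adj?   = λ i j → decode i ~? decode j
    ; sym    = λ {i} {j} → ~-sym (decode i) (decode j)
    ; irrefl = λ { ≡.refl → ~-irrefl _ }
    }

  open Graph graph using (Adj)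

  encode-~ : ∀ {u v} → u ~ v → Adj (encode u) (encode v)
  encode-~ {u} {v} =
    ≡.subst₂ _~_ (≡.sym (decode-encode u)) (≡.sym (decode-encode v))

  T~Lˡ : ∀ a b → Adj (T a) (L a b)
  T~Lˡ a b = encode-~ {terminal a} {link a b} (inj₁ ≡.refl)

  T~Lʳ : ∀ a b → Adj (T b) (L a b)
  T~Lʳ a b = encode-~ {terminal b} {link a b} (inj₂ ≡.refl)

  -- The weighted, precolored instance.

  module GadgetInstance {c ℓ₁ ℓ₂} (F : OrderedField c ℓ₁ ℓ₂) where
    open OrderedField F hiding (zero)
    open OrderedFieldProperties F
    open Extrema F
    open MHV F
    open SumProperties semiring
      using (sum-cong-≋; sum-replicate; *-distribˡ-sum; ∑-distrib-+)
    open PosetReasoning poset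

    vertexWeight : Vertex → Carrier
    vertexWeight (terminal _) = 1#
    vertexWeight (link _ _)   = 0#

    vertexWeight-nonNeg : ∀ v → 0# ≤ vertexWeight v
    vertexWeight-nonNeg (terminal _) = 0≤1
    vertexWeight-nonNeg (link _ _)   = ≤-refl

    vertexPrecolor : Vertex → Maybe (Fin k)
    vertexPrecolor (terminal a) = just a
    vertexPrecolor (link _ _)   = nothing

    gadget : Instance k
    gadget = record
      { n             = size
      ; graph         = graph
      ; weight        = vertexWeight ∘ decode
      ; weight-nonNeg = vertexWeight-nonNeg ∘ decode
      ; precolor      = vertexPrecolor ∘ decode
      ; color-used    = λ a → T a , ≡.cong vertexPrecolor (decode-T a)
      }

    open Instance gadget using (weight; precolor; N[_])

    precolor-T : ∀ a → precolor (T a) ≡ just a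
    precolor-T a = ≡.cong vertexPrecolor (decode-T a)

    weight-T : ∀ a → weight (T a) ≈ 1#
    weight-T a = reflexive (≡.cong vertexWeight (decode-T a))

    weight-↑ʳ : ∀ p → weight (k ↑ʳ p) ≈ 0#
    weight-↑ʳ p = reflexive (≡.cong vertexWeight (decode-↑ʳ p))

    -- Since links have weight zero, this reduces both the happy weight and the LP objective to sums
    -- over the terminals.
    sum-terminals : ∀ (g : Fin size → Carrier) → (∀ p → g (k ↑ʳ p) ≈ 0#) →
                    sum g ≈ sum (g ∘ T)
    sum-terminals g g≈0 = begin-equality
      sum g                               ≈⟨ sum-split k g ⟩
      sum (g ∘ T) + sum (g ∘ (k ↑ʳ_))     ≈⟨ +-congˡ (sum-zero g≈0) ⟩
      sum (g ∘ T) + 0#                    ≈⟨ +-identityʳ (sum (g ∘ T)) ⟩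
      sum (g ∘ T)                         ∎

    -- The optimum of MHV is 1.

    happyTerm : (Fin size → Fin k) → Fin size → Carrier
    happyTerm f j = if does (happy? gadget f j) then weight j else 0#

    happyTerm-happy : ∀ {f j} → Happy gadget f j → happyTerm f j ≈ weight j
    happyTerm-happy {f} {j} happy = reflexive (if-yes (happy? gadget f j) happy)

    happyTerm-unhappy : ∀ {f j} → ¬ Happy gadget f j → happyTerm f j ≈ 0#
    happyTerm-unhappy {f} {j} unhappy = reflexive (if-no (happy? gadget f j) unhappy)

    happyTerm-nonNeg : ∀ f j → 0# ≤ happyTerm f j
    happyTerm-nonNeg f j =
      if-both (0# ≤_) (does (happy? gadget f j)) (vertexWeight-nonNeg (decode j)) ≤-refl

    happyTerm-↑ʳ : ∀ f p → happyTerm f (k ↑ʳ p) ≈ 0#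
    happyTerm-↑ʳ f p =
      if-both (_≈ 0#) (does (happy? gadget f (k ↑ʳ p))) (weight-↑ʳ p) refl

    -- A happy terminal imposes its precolor on all its neighbors, and `L a b` is a neighbor of both
    -- terminals.
    happy-T-unique : ∀ {f} → Extends gadget f → ∀ {a b} →
                     Happy gadget f (T a) → Happy gadget f (T b) → a ≡ b
    happy-T-unique {f} ext {a} {b} happy-a happy-b =
      ≡.trans (≡.sym (link-color (T~Lˡ a b) happy-a)) (link-color (T~Lʳ a b) happy-b)
      where
      link-color : ∀ {a j} → Adj (T a) j → Happy gadget f (T a) → f j ≡ a
      link-color {a} {j} adj happy = ≡.trans (happy j adj) (ext (T a) a (precolor-T a))

    happyWeight≤1 : ∀ {f} → Extends gadget f → happyWeight gadget f ≤ 1#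
    -- Either some terminal is happy, and then it is the only nonzero term, or every term vanishes.
    happyWeight≤1 {f} ext with any? (λ a → happy? gadget f (T a))
    ... | yes (a , happy-a) = begin
      happyWeight gadget f         ≈⟨ sum-terminals (happyTerm f) (happyTerm-↑ʳ f) ⟩
      sum (happyTerm f ∘ T)        ≈⟨ sum-single a (λ b b≢a → happyTerm-unhappy
                                        λ happy-b → b≢a (happy-T-unique ext happy-b happy-a)) ⟩
      happyTerm f (T a)            ≈⟨ happyTerm-happy happy-a ⟩
      weight (T a)                 ≈⟨ weight-T a ⟩
      1#                           ∎
    ... | no unhappy = begin
      happyWeight gadget f         ≈⟨ sum-terminals (happyTerm f) (happyTerm-↑ʳ f) ⟩
      sum (happyTerm f ∘ T)        ≈⟨ sum-zero (λ a → happyTerm-unhappy λ happy-a → unhappy (a , happy-a)) ⟩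
      0#                           ≤⟨ 0≤1 ⟩
      1#                           ∎

    -- Coloring all links alike makes the terminal of that color happy, which already attains the
    -- bound 1.
    vertexColor : Vertex → Fin k
    vertexColor (terminal a) = a
    vertexColor (link _ _)   = someColor

    color : Fin size → Fin k
    color = vertexColor ∘ decode

    color-extends : Extends gadget color
    color-extends j i eq with decode j
    color-extends j i ≡.refl | terminal .i = ≡.refl

    color-happy : Happy gadget color (T someColor)
    color-happy h adj rewrite decode-T someColor with decode h
    -- The terminal case is absent because adjacency of two terminals reduces to `⊥`.
    ... | link _ _ = ≡.refl

    1≤happyWeight : 1# ≤ happyWeight gadget color
    1≤happyWeight = begin
      1#                           ≈⟨ weight-T someColor ⟨
      weight (T someColor)         ≈⟨ happyTerm-happy color-happy ⟨
      happyTerm color (T someColor) ≤⟨ term≤sum (happyTerm-nonNeg color) (T someColor) ⟩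
      happyWeight gadget color     ∎

    opt-MHV : IsOptMHV gadget 1#
    opt-MHV =
      (color , color-extends , antisym 1≤happyWeight (happyWeight≤1 color-extends)) ,
      λ { x (f , ext , x≈hw) → ≤-trans (≤-reflexive x≈hw) (happyWeight≤1 ext) }

    -- The half-integral LP solution and its value.

    δ : Fin k → Fin k → Carrier
    δ a i = if does (a ≟ i) then 1# else 0#

    δ-refl : ∀ a → δ a a ≈ 1#
    δ-refl a = reflexive (if-yes (a ≟ a) ≡.refl)

    δ-≢ : ∀ {a i} → a ≢ i → δ a i ≈ 0#
    δ-≢ {a} {i} a≢i = reflexive (if-no (a ≟ i) a≢i)

    δ-nonNeg : ∀ a i → 0# ≤ δ a i
    δ-nonNeg a i = if-both (0# ≤_) (does (a ≟ i)) 0≤1 ≤-refl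

    δ≤1 : ∀ a i → δ a i ≤ 1#
    δ≤1 a i = if-both (_≤ 1#) (does (a ≟ i)) ≤-refl 0≤1

    sum-δ : ∀ a → sum (δ a) ≈ 1#
    sum-δ a = trans (sum-single a (λ i i≢a → δ-≢ (i≢a ∘ ≡.sym))) (δ-refl a)

    -- `Z` is the closed-neighborhood minimum of `Y` in closed form. At a terminal, every adjacent
    -- link keeps at least half of its color, and some link keeps exactly half. At a link the
    -- minimum is that of the 0/1 values `δ a i` and `δ b i`, which is their product; the link's own
    -- value is their mean and never smaller.
    Y Z : Vertex → Fin k → Carrier
    Y (terminal a) i = δ a i
    Y (link a b)   i = ½ * (δ a i + δ b i)
    Z (terminal a) i = ½ * δ a i
    Z (link a b)   i = δ a i * δ b i

    Y-sum : ∀ v → sum (Y v) ≈ 1#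
    Y-sum (terminal a) = sum-δ a
    Y-sum (link a b)   = begin-equality
      sum (λ i → ½ * (δ a i + δ b i))  ≈⟨ *-distribˡ-sum ½ (λ i → δ a i + δ b i) ⟨
      ½ * sum (λ i → δ a i + δ b i)    ≈⟨ *-congˡ (∑-distrib-+ (δ a) (δ b)) ⟩
      ½ * (sum (δ a) + sum (δ b))      ≈⟨ *-congˡ (+-cong (sum-δ a) (sum-δ b)) ⟩
      ½ * (1# + 1#)                    ≈⟨ ½*[x+x]≈x 1# ⟩
      1#                               ∎

    Y-nonNeg : ∀ v i → 0# ≤ Y v i
    Y-nonNeg (terminal a) i = δ-nonNeg a i
    Y-nonNeg (link a b)   i = *-nonNeg 0≤½
      (≤-trans (δ-nonNeg a i) (x≤x+y (δ-nonNeg b i)))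

    Z-nonNeg : ∀ v i → 0# ≤ Z v i
    Z-nonNeg (terminal a) i = *-nonNeg 0≤½ (δ-nonNeg a i)
    Z-nonNeg (link a b)   i = *-nonNeg (δ-nonNeg a i) (δ-nonNeg b i)

    Y-precolor : ∀ v i → vertexPrecolor v ≡ just i → Y v i ≈ 1#
    Y-precolor (terminal a) .a ≡.refl = δ-refl a

    δ*δ≤ˡ : ∀ a b i → δ a i * δ b i ≤ δ a i
    δ*δ≤ˡ a b i = x*y≤x (δ-nonNeg a i) (δ≤1 b i)

    δ*δ≤ʳ : ∀ a b i → δ a i * δ b i ≤ δ b i
    δ*δ≤ʳ a b i = ≤-trans (≤-reflexive (*-comm _ _)) (δ*δ≤ˡ b a i)

    Z≤Y : ∀ v i → Z v i ≤ Y v i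
    Z≤Y (terminal a) i = begin
      ½ * δ a i  ≈⟨ *-comm ½ (δ a i) ⟩
      δ a i * ½  ≤⟨ x*y≤x (δ-nonNeg a i) ½≤1 ⟩
      δ a i      ∎
    Z≤Y (link a b) i = begin
      δ a i * δ b i                          ≈⟨ ½*[x+x]≈x _ ⟨
      ½ * (δ a i * δ b i + δ a i * δ b i)    ≤⟨ *-monoˡ-≤-nonNeg 0≤½ (+-mono-≤ (δ*δ≤ˡ a b i) (δ*δ≤ʳ a b i)) ⟩
      ½ * (δ a i + δ b i)                    ∎

    Z≤Y-~ : ∀ u v → u ~ v → ∀ i → Z u i ≤ Y v i
    Z≤Y-~ (terminal a) (link .a c) (inj₁ ≡.refl) i =
      *-monoˡ-≤-nonNeg 0≤½ (x≤x+y (δ-nonNeg c i))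
    Z≤Y-~ (terminal a) (link b .a) (inj₂ ≡.refl) i =
      *-monoˡ-≤-nonNeg 0≤½ (x≤y+x (δ-nonNeg b i))
    Z≤Y-~ (link a b) (terminal .a) (inj₁ ≡.refl) i = δ*δ≤ˡ a b i
    Z≤Y-~ (link a b) (terminal .b) (inj₂ ≡.refl) i = δ*δ≤ʳ a b i

    Z-attained : ∀ u i → ∃[ v ] (v ≡ u ⊎ u ~ v) × Z u i ≈ Y v i
    Z-attained (terminal a) i with a ≟ i
    -- The minimum ½ needs a link from `a` to a different color, which exists because `2 ≤ k`;
    -- `link a a` would carry all of color `a`.
    ... | yes ≡.refl with another 2≤k a
    ...   | b , b≢a = link a b , inj₂ (inj₁ ≡.refl) , *-congˡ (begin-equality
      1#             ≈⟨ +-identityʳ 1# ⟨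
      1# + 0#        ≈⟨ +-cong (δ-refl a) (δ-≢ b≢a) ⟨
      δ a a + δ b a  ∎)
    Z-attained (terminal a) i | no a≢i =
      terminal a , inj₁ ≡.refl , trans (zeroʳ ½) (sym (δ-≢ a≢i))
    -- If `δ b i` is 1, the product equals the value at terminal `a`; otherwise it is 0, the value
    -- at terminal `b`.
    Z-attained (link a b) i with b ≟ i
    ... | yes _  = terminal a , inj₂ (inj₁ ≡.refl) , *-identityʳ (δ a i)
    ... | no b≢i = terminal b , inj₂ (inj₂ ≡.refl) , trans (zeroʳ (δ a i)) (sym (δ-≢ b≢i))

    Z-minimum : ∀ j i → IsMinimum (λ x → ∃[ h ] h ∈ N[ j ] × x ≈ Y (decode h) i) (Z (decode j) i)
    Z-minimum j i = attained , bound
      where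
      attained : ∃[ h ] (h ≡ j ⊎ Adj j h) × Z (decode j) i ≈ Y (decode h) i
      attained with Z-attained (decode j) i
      ... | _ , inj₁ ≡.refl , Z≈Y = j , inj₁ ≡.refl , Z≈Y
      ... | v , inj₂ j~v    , Z≈Y =
        encode v ,
        inj₂ (≡.subst (decode j ~_) (≡.sym (decode-encode v)) j~v) ,
        trans Z≈Y (reflexive (≡.cong (λ u → Y u i) (≡.sym (decode-encode v))))

      bound : ∀ x → ∃[ h ] (h ≡ j ⊎ Adj j h) × x ≈ Y (decode h) i → Z (decode j) i ≤ x
      bound x (_ , inj₁ ≡.refl , x≈Y) = ≤-trans (Z≤Y (decode j) i) (≤-reflexive (sym x≈Y))
      bound x (h , inj₂ j~h    , x≈Y) =
        ≤-trans (Z≤Y-~ (decode j) (decode h) j~h i) (≤-reflexive (sym x≈Y))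

    half-integral : LPFeasible gadget (Y ∘ decode) (Z ∘ decode) (sum ∘ Z ∘ decode)
    half-integral = record
      { y-sum     = Y-sum ∘ decode
      ; y-color   = Y-precolor ∘ decode
      ; zᶜ-min    = Z-minimum
      ; z-sum     = λ _ → refl
      ; y-nonNeg  = Y-nonNeg ∘ decode
      ; zᶜ-nonNeg = Z-nonNeg ∘ decode
      ; z-nonNeg  = sum-nonNeg ∘ Z-nonNeg ∘ decode
      }

    LPvalue : (Fin size → Carrier) → Carrier
    LPvalue z = sum (λ j → weight j * z j)

    LPvalue-terminals : ∀ z → LPvalue z ≈ sum (z ∘ T)
    LPvalue-terminals z = begin-equality
      LPvalue z                          ≈⟨ sum-terminals (λ j → weight j * z j)
                                              (λ p → trans (*-congʳ (weight-↑ʳ p)) (zeroˡ _)) ⟩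
      sum (λ a → weight (T a) * z (T a)) ≈⟨ sum-cong-≋ (λ a →
                                              trans (*-congʳ (weight-T a)) (*-identityˡ (z (T a)))) ⟩
      sum (z ∘ T)                        ∎

    sum-Z-T : ∀ a → sum (Z (decode (T a))) ≈ ½
    sum-Z-T a = begin-equality
      sum (Z (decode (T a)))  ≡⟨ ≡.cong (sum ∘ Z) (decode-T a) ⟩
      sum (λ i → ½ * δ a i)   ≈⟨ *-distribˡ-sum ½ (δ a) ⟨
      ½ * sum (δ a)           ≈⟨ *-congˡ (sum-δ a) ⟩
      ½ * 1#                  ≈⟨ *-identityʳ ½ ⟩
      ½                       ∎

    half-integral-value : LPvalue (sum ∘ Z ∘ decode) ≈ fromℕ k / fromℕ 2
    half-integral-value = begin-equality
      LPvalue (sum ∘ Z ∘ decode)            ≈⟨ LPvalue-terminals (sum ∘ Z ∘ decode) ⟩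
      sum (λ a → sum (Z (decode (T a))))    ≈⟨ sum-cong-≋ sum-Z-T ⟩
      sum {k} (const ½)                     ≈⟨ sum-cong-≋ {k} (λ _ → *-identityʳ ½) ⟨
      sum {k} (const (½ * 1#))              ≈⟨ *-distribˡ-sum {k} ½ (const 1#) ⟨
      ½ * sum {k} (const 1#)                ≈⟨ *-congˡ (sum-replicate k) ⟩
      ½ * fromℕ k                           ≈⟨ *-comm ½ (fromℕ k) ⟩
      fromℕ k / fromℕ 2                     ∎

    -- The upper bound on the LP.

    module _ {y zᶜ z} (feasible : LPFeasible gadget y zᶜ z) where
      open LPFeasible feasible

      zᶜ≤y : ∀ {j h} i → h ∈ N[ j ] → zᶜ j i ≤ y h i
      zᶜ≤y {j} {h} i h∈N with zᶜ-min j i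
      ... | _ , lower = lower (y h i) (h , h∈N , refl)

      -- The precolor takes up the whole unit of mass at the terminal, leaving none for other
      -- colors.
      y-T-≢ : ∀ {a i} → i ≢ a → y (T a) i ≤ 0#
      y-T-≢ {a} {i} i≢a = +-cancelˡ-≤ 1# (begin
        1# + y (T a) i           ≈⟨ +-congʳ (y-color (T a) a (precolor-T a)) ⟨
        y (T a) a + y (T a) i    ≤⟨ pair≤sum (y-nonNeg (T a)) (i≢a ∘ ≡.sym) ⟩
        sum (y (T a))            ≈⟨ y-sum (T a) ⟩
        1#                       ≈⟨ +-identityʳ 1# ⟨
        1# + 0#                  ∎)

      -- Only the terminal's own color can contribute to `z (T a)`: in any other color the minimum
      -- includes the value at the terminal itself, which is zero. The remaining minimum is at most
      -- the value at any neighbor.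
      z-T≤y : ∀ {a h} → Adj (T a) h → z (T a) ≤ y h a
      z-T≤y {a} {h} adj = begin
        z (T a)           ≈⟨ z-sum (T a) ⟩
        sum (zᶜ (T a))    ≈⟨ sum-single a (λ i i≢a → antisym
                               (≤-trans (zᶜ≤y i (inj₁ ≡.refl)) (y-T-≢ i≢a)) (zᶜ-nonNeg (T a) i)) ⟩
        zᶜ (T a) a        ≤⟨ zᶜ≤y a (inj₂ adj) ⟩
        y h a             ∎

      -- Both values are bounded at the common neighbor `L a b`, in two different colors that share
      -- its unit of mass.
      z-T-pair : ∀ {a b} → a ≢ b → z (T a) + z (T b) ≤ 1#
      z-T-pair {a} {b} a≢b = begin
        z (T a) + z (T b)            ≤⟨ +-mono-≤ (z-T≤y (T~Lˡ a b)) (z-T≤y (T~Lʳ a b)) ⟩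
        y (L a b) a + y (L a b) b    ≤⟨ pair≤sum (y-nonNeg (L a b)) a≢b ⟩
        sum (y (L a b))              ≈⟨ y-sum (L a b) ⟩
        1#                           ∎

      LPvalue≤k/2 : LPvalue z ≤ fromℕ k / fromℕ 2
      LPvalue≤k/2 = begin
        LPvalue z                          ≈⟨ LPvalue-terminals z ⟩
        sum (z ∘ T)                        ≈⟨ ½*[x+x]≈x (sum (z ∘ T)) ⟨
        ½ * (sum (z ∘ T) + sum (z ∘ T))    ≤⟨ *-monoˡ-≤-nonNeg 0≤½ (double-sum≤ k (z ∘ T) (2≤n⇒n≢1 2≤k) z-T-pair) ⟩
        ½ * fromℕ k                        ≈⟨ *-comm ½ (fromℕ k) ⟩
        fromℕ k / fromℕ 2                  ∎

    opt-LP : IsOptLP gadget (fromℕ k / fromℕ 2)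
    opt-LP =
      (_ , _ , _ , half-integral , sym half-integral-value) ,
      λ { x (_ , _ , _ , feasible , x≈value) →
          ≤-trans (≤-reflexive x≈value) (LPvalue≤k/2 feasible) }

    -- The ratio of the two optima.

    k/2*2/k≈1 : fromℕ k / fromℕ 2 * (fromℕ 2 / fromℕ k) ≈ 1#
    k/2*2/k≈1 = /-*-/-cancel (fromℕ-≥2≉0 2≤k) (fromℕ-suc≉0 1)

    0<k/2 : 0# < fromℕ k / fromℕ 2
    -- `_<_` means `_≤_` together with `≉`; if `k/2` were zero, its product with `2/k` would be 0
    -- rather than 1.
    0<k/2 = *-nonNeg (fromℕ-nonNeg k) 0≤½ , λ 0≈k/2 →
      0≉1 (trans (sym (zeroˡ _)) (trans (*-congʳ 0≈k/2) k/2*2/k≈1))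

    2/k∈GapRatios : GapRatios k (fromℕ 2 / fromℕ k)
    2/k∈GapRatios =
      gadget , 1# , fromℕ k / fromℕ 2 , opt-MHV , opt-LP , 0<k/2 ,
      -- The ratio is `1#` times the inverse of `k/2`, and that inverse is `2/k` by uniqueness.
      trans (*-inverse-unique k/2*2/k≈1) (sym (*-identityˡ _))

theorem6 : ∀ {c ℓ₁ ℓ₂} (F : OrderedField c ℓ₁ ℓ₂) (k : ℕ) → 2 ≤ℕ k →
    let open OrderedField F in
    let open Extrema F in
    let open MHV F in
    Inf GapRatios k AtMost (fromℕ 2 / fromℕ k)
-- A lower bound of a set lies below each member, so one instance with ratio `2/k` suffices.
theorem6 F k 2≤k b lower = lower _ (Gadget.GadgetInstance.2/k∈GapRatios 2≤k F)
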